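{- For every monic $g\in\mathbb{F}_2[x]$ of degree $m$ and every $A\in\mathbb{F}_2[x]$ with $\deg A<2m$, the Frobenius-factorized reduction algorithm (described in the context), applied to $g$ and $A$, returns $A\bmod g$.
   Context: Here $m\ge1$. Write $g(x)=x^m+\sum_{t\in T}x^t$ with $T\subseteq\{0,\ldots,m-1\}$, and put $\Delta_t=m-t$ for $t\in T$. Polynomials of degree below $m$ are identified with coefficient vectors in $\mathbb{F}_2^m$. For $d\ge 0$, $N^d$ is the truncated right shift: $(N^dy)_i=y_{i+d}$ if $0\le i<m-d$ and $(N^dy)_i=0$ if $m-d\le i<m$; $N^d=0$ for $d\ge m$. For $\deg Y<m$ let $V(Y)=\sum_{t\in T}(x^tY\bmod x^m)$. Empty sums are zero. If $T\subseteq\{0\}$ set $r=0$; otherwise set $\Delta_{\min}=\min\{\Delta_t:t\in T\}$ and $r=\lceil\log_2(m/\Delta_{\min})\rceil$. For $k\ge 0$ let $T_k=\{t\in T:2^k\Delta_t<m\}$. Frobenius-factorized reduction algorithm: split $A=L+x^mH$ with $\deg L,\deg H<m$ and set $Y\leftarrow H$. For $k=0,\ldots,r-1$ in order, read one immutable stage input $Y_{\mathrm{old}}$ (the current value of $Y$), compute synchronously $$Y_{\mathrm{new}}=Y_{\mathrm{old}}+\sum_{t\in T_k}N^{2^k\Delta_t}Y_{\mathrm{old}},$$ and set $Y\leftarrow Y_{\mathrm{new}}$. Finally return $L+V(Y)$. $A\bmod g$ is the unique remainder of degree below $m$ on division of $A$ by $g$. -}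

module Defs where

open import Data.Bool.Base using (if_then_else_)
open import Data.Fin.Base using (Fin; toℕ; fromℕ<)
open import Data.List.Base as List using (List; []; _∷_; allFin; filter; foldl; foldr; replicate; upTo)
open import Data.List.Relation.Unary.All using (all?)
open import Data.Nat.Base using (ℕ; zero; suc; _+_; _*_; _∸_; _^_; _⊓_; _≤_; z≤n; s≤s; NonZero)
open import Data.Nat.Properties
  using (_≟_; _≤?_; _<?_; ≤-trans; +-mono-≤; +-identityʳ; m^n>0; m≤m*n)
open import Data.Parity.Base as ℙ using (Parity; 0ℙ; 1ℙ)
open import Data.Parity.Properties as ℙ using ()
open import Data.Product.Base using (_×_; _,_; ∃-syntax)
open import Data.Vec.Functional as Vector using (Vector)
open import Level using (0ℓ)
open import Relation.Binary.PropositionalEquality.Core using (_≡_; sym; subst)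
open import Relation.Nullary.Decidable using (does; yes; no)
open import Relation.Nullary.Negation using (contradiction)
open import Relation.Unary using (Pred; Decidable)

-- The two-element field: Data.Parity carries its commutative ring structure.
𝔽₂ : Set
𝔽₂ = Parity

-- Coefficient lists, constant term first.  Trailing zeros are allowed, so
-- equality of polynomials is _≈_ and not _≡_.
Poly : Set
Poly = List 𝔽₂

coeff : Poly → ℕ → 𝔽₂
coeff []      _       = 0ℙ
coeff (a ∷ p) zero    = a
coeff (a ∷ p) (suc i) = coeff p i

infix  4 _≈_
infixl 6 _+ᴾ_
infixl 7 _*ᴾ_

_≈_ : Poly → Poly → Set
p ≈ q = ∀ i → coeff p i ≡ coeff q i

_+ᴾ_ : Poly → Poly → Poly
[]      +ᴾ q       = q
(a ∷ p) +ᴾ []      = a ∷ p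
(a ∷ p) +ᴾ (b ∷ q) = (a ℙ.+ b) ∷ (p +ᴾ q)

_*ᴾ_ : Poly → Poly → Poly
[]      *ᴾ q = []
(a ∷ p) *ᴾ q = List.map (a ℙ.*_) q +ᴾ (0ℙ ∷ (p *ᴾ q))

X^_ : ℕ → Poly
X^ n = replicate n 0ℙ List.++ (1ℙ ∷ [])

-- deg p < d; the zero polynomial satisfies this for every d.
Deg< : Poly → ℕ → Set
Deg< p d = ∀ i → d ≤ i → coeff p i ≡ 0ℙ

MonicOfDegree : ℕ → Poly → Set
MonicOfDegree m g = coeff g m ≡ 1ℙ × Deg< g (suc m)

-- R is a remainder of A on division by g, where m is the degree of g.
IsRemainder : ℕ → Poly → Poly → Poly → Set
IsRemainder m g A R = Deg< R m × ∃[ Q ] A ≈ Q *ᴾ g +ᴾ R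

-- R = A mod g: R is a remainder, and the only one.
IsMod : ℕ → Poly → Poly → Poly → Set
IsMod m g A R = IsRemainder m g A R × (∀ R′ → IsRemainder m g A R′ → R′ ≈ R)

⟦_⟧ : ∀ {m} → Vector 𝔽₂ m → Poly
⟦ y ⟧ = Vector.toList y

-- p mod x^m, as a coefficient vector.
low : ∀ m → Poly → Vector 𝔽₂ m
low m p i = coeff p (toℕ i)

-- For deg p < 2m this is the H of p = L + x^m H, with L = low m p.
high : ∀ m → Poly → Vector 𝔽₂ m
high m p i = coeff p (m + toℕ i)

infixl 6 _⊕_

_⊕_ : ∀ {m} → Vector 𝔽₂ m → Vector 𝔽₂ m → Vector 𝔽₂ m
_⊕_ = Vector.zipWith ℙ._+_

⨁ : ∀ {A : Set} {m} → List A → (A → Vector 𝔽₂ m) → Vector 𝔽₂ m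
⨁ ts f = foldr (λ t s → f t ⊕ s) (λ _ → 0ℙ) ts

-- The test i + d < m is i < m - d over the integers, so it fails
-- everywhere when d ≥ m.
N^ : ∀ {m} → ℕ → Vector 𝔽₂ m → Vector 𝔽₂ m
N^ {m} d y i with toℕ i + d <? m
... | yes i+d<m = y (fromℕ< i+d<m)
... | no  _     = 0ℙ

-- The least k < b satisfying P, or b if there is none.
least : {P : Pred ℕ 0ℓ} → Decidable P → ℕ → ℕ
least P? zero    = zero
least P? (suc b) with P? 0
... | yes _ = 0
... | no  _ = suc (least (λ k → P? (suc k)) b)

-- The least natural number k with log₂ (n / d) ≤ k, that is n / d ≤ 2^k,
-- cleared of denominators.  For 1 ≤ d ≤ n the logarithm is nonnegative, so
-- this is its ceiling.  The bound n on the search suffices because n ≤ 2^n.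
⌈log₂_/_⌉ : ℕ → ℕ → ℕ
⌈log₂ n / d ⌉ = least (λ k → n ≤? 2 ^ k * d) n

least-satisfies : {P : Pred ℕ 0ℓ} (P? : Decidable P) (b : ℕ) → P b → P (least P? b)
least-satisfies P? zero    Pb = Pb
least-satisfies P? (suc b) Pb with P? 0
... | yes P0 = P0
... | no  _  = least-satisfies (λ k → P? (suc k)) b Pb

least-minimal : {P : Pred ℕ 0ℓ} (P? : Decidable P) (b j : ℕ) → P j → least P? b ≤ j
least-minimal P? zero    j Pj = z≤n
least-minimal P? (suc b) j Pj with P? 0
... | yes _ = z≤n
least-minimal P? (suc b) zero    Pj | no ¬P0 = contradiction Pj ¬P0
least-minimal P? (suc b) (suc j) Pj | no _   = s≤s (least-minimal (λ k → P? (suc k)) b j Pj)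

n≤2^n : ∀ n → n ≤ 2 ^ n
n≤2^n zero    = z≤n
n≤2^n (suc n) = +-mono-≤ (m^n>0 2 n) (subst (n ≤_) (sym (+-identityʳ (2 ^ n))) (n≤2^n n))

⌈log₂/⌉-upper : ∀ n d .{{_ : NonZero d}} → n ≤ 2 ^ ⌈log₂ n / d ⌉ * d
⌈log₂/⌉-upper n d =
  least-satisfies (λ k → n ≤? 2 ^ k * d) n (≤-trans (n≤2^n n) (m≤m*n (2 ^ n) d))

⌈log₂/⌉-least : ∀ n d j → n ≤ 2 ^ j * d → ⌈log₂ n / d ⌉ ≤ j
⌈log₂/⌉-least n d = least-minimal (λ k → n ≤? 2 ^ k * d) n

-- T, listed without repetition: g = x^m + ∑_{t ∈ T} x^t when g is monic of
-- degree m.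
exponents : ∀ m → Poly → List (Fin m)
exponents m g = filter (λ t → coeff g (toℕ t) ℙ.≟ 1ℙ) (allFin m)

Δ : ∀ {m} → Fin m → ℕ
Δ {m} t = m ∸ toℕ t

-- Every Δ t is at most m, so the starting value m does not affect the
-- minimum when T is nonempty.
Δmin : ∀ {m} → List (Fin m) → ℕ
Δmin {m} T = foldr (λ t s → Δ t ⊓ s) m T

stageCount : ∀ {m} → List (Fin m) → ℕ
stageCount {m} T =
  if does (all? (λ t → toℕ t ≟ 0) T) then 0 else ⌈log₂ m / Δmin T ⌉

active : ∀ {m} → List (Fin m) → ℕ → List (Fin m)
active {m} T k = filter (λ t → 2 ^ k * Δ t <? m) T

V : ∀ {m} → List (Fin m) → Vector 𝔽₂ m → Vector 𝔽₂ m
V {m} T Y = ⨁ T (λ t → low m ((X^ toℕ t) *ᴾ ⟦ Y ⟧))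

stage : ∀ {m} → List (Fin m) → Vector 𝔽₂ m → ℕ → Vector 𝔽₂ m
stage T Y k = Y ⊕ ⨁ (active T k) (λ t → N^ (2 ^ k * Δ t) Y)

frobeniusReduce : ℕ → Poly → Poly → Poly
frobeniusReduce m g A = ⟦ low m A ⊕ V T (foldl (stage T) (high m A) (upTo (stageCount T))) ⟧
  where
  T : List (Fin m)
  T = exponents m g

{-# OPTIONS --safe #-}

-- Let U be the sum of the shifts N^Δ_t over t ∈ T.  Over 𝔽₂ the cross terms of
-- a square cancel, so U^(2^k) is the sum of the shifts N^(2^k Δ_t), and stage k
-- multiplies Y by I + U^(2^k).  Since (I + U) ∏_{k < r} (I + U^(2^k)) = I + U^(2^r)
-- and U^(2^r) = 0, the final Y solves Y + U Y = H.  As the coefficient of x^(m+i)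
-- in Y g is (Y + U Y)_i, the product Y g cancels the high half of A, and Y is
-- the quotient; below x^m, Y g agrees with V(Y).
module Submission where

open import Defs
open import Algebra.Properties.CommutativeSemigroup using (interchange; x∙yz≈y∙xz)
open import Data.Fin.Base as Fin using (Fin; toℕ; fromℕ<)
open import Data.Fin.Properties using (toℕ-fromℕ<; toℕ<n)
open import Data.List.Base using (List; []; _∷_; allFin; filter; foldl; map; tabulate; upTo)
open import Data.List.Properties using (foldl-∷ʳ; upTo-∷ʳ)
open import Data.List.Relation.Unary.All as All using (All; []; _∷_; all?)
open import Data.Nat.Base using (ℕ; zero; suc; _+_; _*_; _∸_; _^_; _≤_; _<_; z≤n; s≤s; >-nonZero)
open import Data.Nat.Properties
  using (_≟_; _<?_; ≤-refl; ≤-reflexive; ≤-trans; <⇒≤; ≮⇒≥; +-assoc; +-comm; +-identityʳ;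
         +-monoʳ-≤; *-identityˡ; *-distribʳ-+; *-monoʳ-≤; m≤m+n; m≤n+m; m+[n∸m]≡n;
         m<n⇒0<n∸m; ⊓-glb; m⊓n≤m; m⊓n≤n)
open import Data.Parity.Base as ℙ using (0ℙ; 1ℙ)
open import Data.Parity.Properties as ℙ using ()
open import Data.Product.Base using (_,_)
open import Data.Vec.Functional using (Vector)
open import Function.Base using (_∘_)
open import Level using (0ℓ)
open import Relation.Binary.PropositionalEquality
  using (_≡_; refl; sym; trans; cong; cong₂; subst; module ≡-Reasoning)
open import Relation.Nullary.Decidable using (yes; no)
open import Relation.Nullary.Negation using (¬_; contradiction)
open import Relation.Unary using (Pred; Decidable)

open ≡-Reasoning

private
  variable
    A B : Set

-- Arithmetic in the field of two elements

+-interchange : ∀ a b c d → (a ℙ.+ b) ℙ.+ (c ℙ.+ d) ≡ (a ℙ.+ c) ℙ.+ (b ℙ.+ d)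
+-interchange = interchange ℙ.+-commutativeSemigroup

-- Characteristic two kills the repeated term. This is how cross terms vanish in `∑-symmetric` and
-- `[1+U]-telescope`.
+-cancel-middle : ∀ a b c → (a ℙ.+ b) ℙ.+ (b ℙ.+ c) ≡ a ℙ.+ c
+-cancel-middle a b c = begin
  (a ℙ.+ b) ℙ.+ (b ℙ.+ c)  ≡⟨ ℙ.+-assoc a b (b ℙ.+ c) ⟩
  a ℙ.+ (b ℙ.+ (b ℙ.+ c))  ≡⟨ cong (a ℙ.+_) (ℙ.+-assoc b b c) ⟨
  a ℙ.+ ((b ℙ.+ b) ℙ.+ c)  ≡⟨ cong (λ z → a ℙ.+ (z ℙ.+ c)) (ℙ.p+p≡0ℙ b) ⟩
  a ℙ.+ c                  ∎

+≡0⇒≡ : ∀ a b → a ℙ.+ b ≡ 0ℙ → a ≡ b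
+≡0⇒≡ a b a+b≡0 = ℙ.+-cancelʳ-≡ b a b (trans a+b≡0 (sym (ℙ.p+p≡0ℙ b)))

-- Finite sums over 𝔽₂

∑ : List A → (A → 𝔽₂) → 𝔽₂
∑ []       f = 0ℙ
∑ (x ∷ xs) f = f x ℙ.+ ∑ xs f

∑-cong : ∀ (xs : List A) {f g : A → 𝔽₂} → (∀ x → f x ≡ g x) → ∑ xs f ≡ ∑ xs g
∑-cong []       f≗g = refl
∑-cong (x ∷ xs) f≗g = cong₂ ℙ._+_ (f≗g x) (∑-cong xs f≗g)

∑-zero : ∀ {xs : List A} {f : A → 𝔽₂} → All (λ x → f x ≡ 0ℙ) xs → ∑ xs f ≡ 0ℙ
∑-zero []              = refl
∑-zero (fx≡0 ∷ fxs≡0) = cong₂ ℙ._+_ fx≡0 (∑-zero fxs≡0)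

∑-+ : ∀ (xs : List A) (f g : A → 𝔽₂) → ∑ xs (λ x → f x ℙ.+ g x) ≡ ∑ xs f ℙ.+ ∑ xs g
∑-+ []       f g = refl
∑-+ (x ∷ xs) f g = begin
  (f x ℙ.+ g x) ℙ.+ ∑ xs (λ x → f x ℙ.+ g x)  ≡⟨ cong ((f x ℙ.+ g x) ℙ.+_) (∑-+ xs f g) ⟩
  (f x ℙ.+ g x) ℙ.+ (∑ xs f ℙ.+ ∑ xs g)       ≡⟨ +-interchange (f x) (g x) (∑ xs f) (∑ xs g) ⟩
  (f x ℙ.+ ∑ xs f) ℙ.+ (g x ℙ.+ ∑ xs g)       ∎

∑-swap : ∀ (xs : List A) (ys : List B) (f : A → B → 𝔽₂) →
         ∑ xs (λ x → ∑ ys (f x)) ≡ ∑ ys (λ y → ∑ xs (λ x → f x y))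
∑-swap []       ys f = sym (∑-zero (All.universal (λ _ → refl) ys))
∑-swap (x ∷ xs) ys f = begin
  ∑ ys (f x) ℙ.+ ∑ xs (λ x → ∑ ys (f x))          ≡⟨ cong (∑ ys (f x) ℙ.+_) (∑-swap xs ys f) ⟩
  ∑ ys (f x) ℙ.+ ∑ ys (λ y → ∑ xs (λ x → f x y))  ≡⟨ ∑-+ ys (f x) (λ y → ∑ xs (λ x → f x y)) ⟨
  ∑ ys (λ y → f x y ℙ.+ ∑ xs (λ x → f x y))       ∎

-- Off-diagonal terms occur in equal pairs and cancel in characteristic two, so only the diagonal
-- survives. This is the Frobenius identity behind `U-square`.
∑-symmetric : ∀ (xs : List A) (f : A → A → 𝔽₂) → (∀ x y → f x y ≡ f y x) →
              ∑ xs (λ x → ∑ xs (f x)) ≡ ∑ xs (λ x → f x x)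
∑-symmetric []       f f-sym = refl
∑-symmetric (x ∷ xs) f f-sym = begin
  (f x x ℙ.+ ∑ xs (f x)) ℙ.+ ∑ xs (λ y → f y x ℙ.+ ∑ xs (f y))
    ≡⟨ cong ((f x x ℙ.+ ∑ xs (f x)) ℙ.+_) (∑-+ xs (λ y → f y x) (λ y → ∑ xs (f y))) ⟩
  (f x x ℙ.+ ∑ xs (f x)) ℙ.+ (∑ xs (λ y → f y x) ℙ.+ ∑ xs (λ y → ∑ xs (f y)))
    ≡⟨ cong (λ z → (f x x ℙ.+ ∑ xs (f x)) ℙ.+ (z ℙ.+ _)) (∑-cong xs (λ y → f-sym y x)) ⟩
  (f x x ℙ.+ ∑ xs (f x)) ℙ.+ (∑ xs (f x) ℙ.+ ∑ xs (λ y → ∑ xs (f y)))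
    ≡⟨ +-cancel-middle (f x x) (∑ xs (f x)) _ ⟩
  f x x ℙ.+ ∑ xs (λ y → ∑ xs (f y))
    ≡⟨ cong (f x x ℙ.+_) (∑-symmetric xs f f-sym) ⟩
  f x x ℙ.+ ∑ xs (λ y → f y y)
    ∎

-- A dropped entry contributes zero to the full sum. Letting `f` and `g` differ absorbs the
-- coefficients of `g` in `coeff-monic-*ᴾ` and the truncation of the shifts in `coeff-stage`.
∑-filter : ∀ {P : Pred A 0ℓ} (P? : Decidable P) (xs : List A) {f g : A → 𝔽₂} →
           (∀ x → P x → f x ≡ g x) → (∀ x → ¬ P x → g x ≡ 0ℙ) →
           ∑ (filter P? xs) f ≡ ∑ xs g
∑-filter P? []       f≡g g≡0 = refl
∑-filter P? (x ∷ xs) {g = g} f≡g g≡0 with P? x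
... | yes Px = cong₂ ℙ._+_ (f≡g x Px) (∑-filter P? xs f≡g g≡0)
... | no ¬Px = trans (∑-filter P? xs f≡g g≡0) (cong (ℙ._+ ∑ xs g) (sym (g≡0 x ¬Px)))

-- The tail of `allFin (suc n)` is `tabulate Fin.suc`; reindexing turns a sum over it into one over
-- `allFin n`.
∑-tabulate : ∀ {n} (h : Fin n → A) (f : A → 𝔽₂) → ∑ (tabulate h) f ≡ ∑ (allFin n) (f ∘ h)
∑-tabulate {n = zero}  h f = refl
∑-tabulate {n = suc n} h f =
  cong (f (h Fin.zero) ℙ.+_)
    (trans (∑-tabulate (h ∘ Fin.suc) f) (sym (∑-tabulate Fin.suc (f ∘ h))))

⨁-apply : ∀ {m} (ts : List A) (f : A → Vector 𝔽₂ m) i → ⨁ ts f i ≡ ∑ ts (λ t → f t i)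
⨁-apply []       f i = refl
⨁-apply (t ∷ ts) f i = cong (f t i ℙ.+_) (⨁-apply ts f i)

-- Coefficients of polynomials

coeff-+ᴾ : ∀ p q i → coeff (p +ᴾ q) i ≡ coeff p i ℙ.+ coeff q i
coeff-+ᴾ []      q       i       = refl
coeff-+ᴾ (a ∷ p) []      i       = sym (ℙ.+-identityʳ (coeff (a ∷ p) i))
coeff-+ᴾ (a ∷ p) (b ∷ q) zero    = refl
coeff-+ᴾ (a ∷ p) (b ∷ q) (suc i) = coeff-+ᴾ p q i

coeff-map : ∀ a p i → coeff (map (a ℙ.*_) p) i ≡ a ℙ.* coeff p i
coeff-map a []      i       = sym (ℙ.*-zeroʳ a)
coeff-map a (b ∷ p) zero    = refl
coeff-map a (b ∷ p) (suc i) = coeff-map a p i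

∷-cong : ∀ a {p q} → p ≈ q → (a ∷ p) ≈ (a ∷ q)
∷-cong a p≈q zero    = refl
∷-cong a p≈q (suc i) = p≈q i

coeff-∷-*ᴾ : ∀ a p q i → coeff ((a ∷ p) *ᴾ q) i ≡ (a ℙ.* coeff q i) ℙ.+ coeff (0ℙ ∷ p *ᴾ q) i
coeff-∷-*ᴾ a p q i =
  trans (coeff-+ᴾ (map (a ℙ.*_) q) (0ℙ ∷ p *ᴾ q) i)
        (cong (ℙ._+ coeff (0ℙ ∷ p *ᴾ q) i) (coeff-map a q i))

*ᴾ-zeroʳ : ∀ p → p *ᴾ [] ≈ []
*ᴾ-zeroʳ []      i       = refl
*ᴾ-zeroʳ (a ∷ p) zero    = refl
*ᴾ-zeroʳ (a ∷ p) (suc i) = *ᴾ-zeroʳ p i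

-- `_*ᴾ_` recurses on its left factor only; this is the matching recursion on the right factor, from
-- which commutativity follows.
coeff-*ᴾ-∷ : ∀ p b q i → coeff (p *ᴾ (b ∷ q)) i ≡ (b ℙ.* coeff p i) ℙ.+ coeff (0ℙ ∷ p *ᴾ q) i
coeff-*ᴾ-∷ []      b q zero    = sym (trans (ℙ.+-identityʳ _) (ℙ.*-zeroʳ b))
coeff-*ᴾ-∷ []      b q (suc i) = sym (trans (ℙ.+-identityʳ _) (ℙ.*-zeroʳ b))
coeff-*ᴾ-∷ (a ∷ p) b q zero    = cong (ℙ._+ 0ℙ) (ℙ.*-comm a b)
coeff-*ᴾ-∷ (a ∷ p) b q (suc i) = begin
  coeff ((a ∷ p) *ᴾ (b ∷ q)) (suc i)
    ≡⟨ coeff-∷-*ᴾ a p (b ∷ q) (suc i) ⟩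
  (a ℙ.* coeff q i) ℙ.+ coeff (p *ᴾ (b ∷ q)) i
    ≡⟨ cong ((a ℙ.* coeff q i) ℙ.+_) (coeff-*ᴾ-∷ p b q i) ⟩
  (a ℙ.* coeff q i) ℙ.+ ((b ℙ.* coeff p i) ℙ.+ coeff (0ℙ ∷ p *ᴾ q) i)
    ≡⟨ x∙yz≈y∙xz ℙ.+-commutativeSemigroup (a ℙ.* coeff q i) (b ℙ.* coeff p i) _ ⟩
  (b ℙ.* coeff p i) ℙ.+ ((a ℙ.* coeff q i) ℙ.+ coeff (0ℙ ∷ p *ᴾ q) i)
    ≡⟨ cong ((b ℙ.* coeff p i) ℙ.+_) (coeff-∷-*ᴾ a p q i) ⟨
  (b ℙ.* coeff p i) ℙ.+ coeff ((a ∷ p) *ᴾ q) i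
    ∎

*ᴾ-comm : ∀ p q → p *ᴾ q ≈ q *ᴾ p
*ᴾ-comm []      q i = sym (*ᴾ-zeroʳ q i)
*ᴾ-comm (a ∷ p) q i = begin
  coeff ((a ∷ p) *ᴾ q) i                          ≡⟨ coeff-∷-*ᴾ a p q i ⟩
  (a ℙ.* coeff q i) ℙ.+ coeff (0ℙ ∷ p *ᴾ q) i     ≡⟨ cong ((a ℙ.* coeff q i) ℙ.+_) (∷-cong 0ℙ (*ᴾ-comm p q) i) ⟩
  (a ℙ.* coeff q i) ℙ.+ coeff (0ℙ ∷ q *ᴾ p) i     ≡⟨ coeff-*ᴾ-∷ q a p i ⟨
  coeff (q *ᴾ (a ∷ p)) i                          ∎

*ᴾ-distribʳ-+ᴾ : ∀ r p q i → coeff ((p +ᴾ q) *ᴾ r) i ≡ coeff (p *ᴾ r) i ℙ.+ coeff (q *ᴾ r) i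
*ᴾ-distribʳ-+ᴾ r []      q       i = refl
*ᴾ-distribʳ-+ᴾ r (a ∷ p) []      i = sym (ℙ.+-identityʳ _)
*ᴾ-distribʳ-+ᴾ r (a ∷ p) (b ∷ q) i = begin
  coeff ((a ℙ.+ b ∷ p +ᴾ q) *ᴾ r) i
    ≡⟨ coeff-∷-*ᴾ (a ℙ.+ b) (p +ᴾ q) r i ⟩
  ((a ℙ.+ b) ℙ.* coeff r i) ℙ.+ coeff (0ℙ ∷ (p +ᴾ q) *ᴾ r) i
    ≡⟨ cong₂ ℙ._+_ (ℙ.*-distribʳ-+ (coeff r i) a b) (tail i) ⟩
  ((a ℙ.* coeff r i) ℙ.+ (b ℙ.* coeff r i)) ℙ.+ (coeff (0ℙ ∷ p *ᴾ r) i ℙ.+ coeff (0ℙ ∷ q *ᴾ r) i)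
    ≡⟨ +-interchange (a ℙ.* coeff r i) (b ℙ.* coeff r i) _ _ ⟩
  ((a ℙ.* coeff r i) ℙ.+ coeff (0ℙ ∷ p *ᴾ r) i) ℙ.+ ((b ℙ.* coeff r i) ℙ.+ coeff (0ℙ ∷ q *ᴾ r) i)
    ≡⟨ cong₂ ℙ._+_ (coeff-∷-*ᴾ a p r i) (coeff-∷-*ᴾ b q r i) ⟨
  coeff ((a ∷ p) *ᴾ r) i ℙ.+ coeff ((b ∷ q) *ᴾ r) i
    ∎
  where
  tail : ∀ i → coeff (0ℙ ∷ (p +ᴾ q) *ᴾ r) i ≡ coeff (0ℙ ∷ p *ᴾ r) i ℙ.+ coeff (0ℙ ∷ q *ᴾ r) i
  tail zero    = refl
  tail (suc i) = *ᴾ-distribʳ-+ᴾ r p q i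

-- Products with powers of x, and expansion of a product along its left factor

coeff-X^0-*ᴾ : ∀ p i → coeff ((X^ 0) *ᴾ p) i ≡ coeff p i
coeff-X^0-*ᴾ p zero    = trans (coeff-∷-*ᴾ 1ℙ [] p 0) (ℙ.+-identityʳ _)
coeff-X^0-*ᴾ p (suc i) = trans (coeff-∷-*ᴾ 1ℙ [] p (suc i)) (ℙ.+-identityʳ _)

coeff-X^-*ᴾ-≥ : ∀ n p i → coeff ((X^ n) *ᴾ p) (n + i) ≡ coeff p i
coeff-X^-*ᴾ-≥ zero    p i = coeff-X^0-*ᴾ p i
coeff-X^-*ᴾ-≥ (suc n) p i =
  trans (coeff-∷-*ᴾ 0ℙ (X^ n) p (suc n + i)) (coeff-X^-*ᴾ-≥ n p i)

coeff-X^-*ᴾ-< : ∀ n p {i} → i < n → coeff ((X^ n) *ᴾ p) i ≡ 0ℙ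
coeff-X^-*ᴾ-< (suc n) p {zero}  _         = coeff-∷-*ᴾ 0ℙ (X^ n) p 0
coeff-X^-*ᴾ-< (suc n) p {suc i} (s≤s i<n) =
  trans (coeff-∷-*ᴾ 0ℙ (X^ n) p (suc i)) (coeff-X^-*ᴾ-< n p i<n)

-- A list representing zero may still be a nonempty list of zeros, so the product does not simply
-- reduce to `[]`.
≈0⇒*ᴾ≈0 : ∀ p q → p ≈ [] → p *ᴾ q ≈ []
≈0⇒*ᴾ≈0 []      q p≈0 i = refl
≈0⇒*ᴾ≈0 (a ∷ p) q p≈0 i = begin
  coeff ((a ∷ p) *ᴾ q) i                       ≡⟨ coeff-∷-*ᴾ a p q i ⟩
  (a ℙ.* coeff q i) ℙ.+ coeff (0ℙ ∷ p *ᴾ q) i  ≡⟨ cong₂ (λ z w → (z ℙ.* coeff q i) ℙ.+ w) (p≈0 0) (tail i) ⟩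
  0ℙ                                           ∎
  where
  tail : ∀ i → coeff (0ℙ ∷ p *ᴾ q) i ≡ 0ℙ
  tail zero    = refl
  tail (suc i) = ≈0⇒*ᴾ≈0 p q (p≈0 ∘ suc) i

-- The term of exponent `n` is kept outside the sum, so that monicity can be applied to it while the
-- sum runs over the indices that `exponents` filters.
coeff-*ᴾ-expand : ∀ n p q → Deg< p (suc n) → ∀ i →
  coeff (p *ᴾ q) i ≡
  (coeff p n ℙ.* coeff ((X^ n) *ᴾ q) i) ℙ.+
  ∑ (allFin n) (λ t → coeff p (toℕ t) ℙ.* coeff ((X^ toℕ t) *ᴾ q) i)
coeff-*ᴾ-expand n [] q _ i =
  sym (∑-zero (All.universal (λ _ → refl) (allFin n)))
coeff-*ᴾ-expand zero (a ∷ p) q deg i = begin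
  coeff ((a ∷ p) *ᴾ q) i                       ≡⟨ coeff-∷-*ᴾ a p q i ⟩
  (a ℙ.* coeff q i) ℙ.+ coeff (0ℙ ∷ p *ᴾ q) i  ≡⟨ cong₂ (λ z w → (a ℙ.* z) ℙ.+ w) (sym (coeff-X^0-*ᴾ q i)) (tail i) ⟩
  (a ℙ.* coeff ((X^ 0) *ᴾ q) i) ℙ.+ 0ℙ         ∎
  where
  tail : ∀ i → coeff (0ℙ ∷ p *ᴾ q) i ≡ 0ℙ
  tail zero    = refl
  tail (suc i) = ≈0⇒*ᴾ≈0 p q (λ j → deg (suc j) (s≤s z≤n)) i
coeff-*ᴾ-expand (suc n) (a ∷ p) q deg i = begin
  coeff ((a ∷ p) *ᴾ q) i
    ≡⟨ coeff-∷-*ᴾ a p q i ⟩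
  (a ℙ.* coeff q i) ℙ.+ coeff (0ℙ ∷ p *ᴾ q) i
    ≡⟨ cong₂ (λ z w → (a ℙ.* z) ℙ.+ w) (sym (coeff-X^0-*ᴾ q i)) tail-i ⟩
  (a ℙ.* coeff ((X^ 0) *ᴾ q) i) ℙ.+ (lead ℙ.+ rest)
    -- The peeled constant term becomes the summand of index zero, and the leading term stays in
    -- front.
    ≡⟨ x∙yz≈y∙xz ℙ.+-commutativeSemigroup (a ℙ.* coeff ((X^ 0) *ᴾ q) i) lead rest ⟩
  lead ℙ.+ ((a ℙ.* coeff ((X^ 0) *ᴾ q) i) ℙ.+ rest)
    ≡⟨ cong (λ z → lead ℙ.+ ((a ℙ.* coeff ((X^ 0) *ᴾ q) i) ℙ.+ z))
            (∑-tabulate {n = n} Fin.suc (λ t → coeff (a ∷ p) (toℕ t) ℙ.* coeff ((X^ toℕ t) *ᴾ q) i)) ⟨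
  lead ℙ.+ ∑ (allFin (suc n)) (λ t → coeff (a ∷ p) (toℕ t) ℙ.* coeff ((X^ toℕ t) *ᴾ q) i)
    ∎
  where
  lead rest : 𝔽₂
  lead = coeff p n ℙ.* coeff ((X^ suc n) *ᴾ q) i
  rest = ∑ (allFin n) (λ t → coeff p (toℕ t) ℙ.* coeff ((X^ suc (toℕ t)) *ᴾ q) i)

  deg-tail : Deg< p (suc n)
  deg-tail j 1+n≤j = deg (suc j) (s≤s 1+n≤j)

  shift : ∀ c k → c ℙ.* coeff ((X^ suc k) *ᴾ q) i ≡ c ℙ.* coeff (0ℙ ∷ (X^ k) *ᴾ q) i
  shift c k = cong (c ℙ.*_) (coeff-∷-*ᴾ 0ℙ (X^ k) q i)

  tail : ∀ i → coeff (0ℙ ∷ p *ᴾ q) i ≡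
    (coeff p n ℙ.* coeff (0ℙ ∷ (X^ n) *ᴾ q) i) ℙ.+
    ∑ (allFin n) (λ t → coeff p (toℕ t) ℙ.* coeff (0ℙ ∷ (X^ toℕ t) *ᴾ q) i)
  tail zero    = sym (cong₂ ℙ._+_ (ℙ.*-zeroʳ (coeff p n))
    (∑-zero (All.universal (λ t → ℙ.*-zeroʳ (coeff p (toℕ t))) (allFin n))))
  tail (suc i) = coeff-*ᴾ-expand n p q deg-tail i

  tail-i : coeff (0ℙ ∷ p *ᴾ q) i ≡ lead ℙ.+ rest
  tail-i = trans (tail i)
    (sym (cong₂ ℙ._+_ (shift (coeff p n) n) (∑-cong (allFin n) (λ t → shift (coeff p (toℕ t)) (toℕ t)))))

-- Each coefficient of `g` below degree `m` is 0 or 1, so expanding along `g` leaves one shifted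
-- copy of `q` for each exponent of `g`. Commutativity puts `g` on the left, where the expansion
-- applies.
coeff-monic-*ᴾ : ∀ m g → MonicOfDegree m g → ∀ q i →
  coeff (q *ᴾ g) i ≡
  coeff ((X^ m) *ᴾ q) i ℙ.+ ∑ (exponents m g) (λ t → coeff ((X^ toℕ t) *ᴾ q) i)
coeff-monic-*ᴾ m g (gm≡1 , deg) q i = begin
  coeff (q *ᴾ g) i
    ≡⟨ *ᴾ-comm q g i ⟩
  coeff (g *ᴾ q) i
    ≡⟨ coeff-*ᴾ-expand m g q deg i ⟩
  (coeff g m ℙ.* coeff ((X^ m) *ᴾ q) i) ℙ.+
  ∑ (allFin m) (λ t → coeff g (toℕ t) ℙ.* coeff ((X^ toℕ t) *ᴾ q) i)
    ≡⟨ cong₂ ℙ._+_ (cong (ℙ._* coeff ((X^ m) *ᴾ q) i) gm≡1)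
         (sym (∑-filter (λ t → coeff g (toℕ t) ℙ.≟ 1ℙ) (allFin m)
           (λ t gt≡1 → sym (cong (ℙ._* coeff ((X^ toℕ t) *ᴾ q) i) gt≡1))
           (λ t gt≢1 → cong (ℙ._* coeff ((X^ toℕ t) *ᴾ q) i) (≢1⇒≡0 gt≢1)))) ⟩
  coeff ((X^ m) *ᴾ q) i ℙ.+ ∑ (exponents m g) (λ t → coeff ((X^ toℕ t) *ᴾ q) i)
    ∎
  where
  ≢1⇒≡0 : ∀ {a} → ¬ a ≡ 1ℙ → a ≡ 0ℙ
  ≢1⇒≡0 {0ℙ} _   = refl
  ≢1⇒≡0 {1ℙ} a≢1 = contradiction refl a≢1

-- Uniqueness of remainders

-- Induction on the list `p`. Above degree `m` the term `a g` has no coefficients, so `p *ᴾ g`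
-- inherits the degree bound and vanishes by induction. What remains is `a g`, whose coefficient at
-- `m` is `a`, and this is zero by the bound.
monic-*ᴾ-Deg<⇒≈0 : ∀ m g → MonicOfDegree m g → ∀ p → Deg< (p *ᴾ g) m → p *ᴾ g ≈ []
monic-*ᴾ-Deg<⇒≈0 m g monic []      deg i = refl
monic-*ᴾ-Deg<⇒≈0 m g monic@(gm≡1 , deg-g) (a ∷ p) deg i = begin
  coeff ((a ∷ p) *ᴾ g) i  ≡⟨ head-only i ⟩
  a ℙ.* coeff g i         ≡⟨ cong (ℙ._* coeff g i) a≡0 ⟩
  0ℙ                      ∎
  where
  pg≈0 : p *ᴾ g ≈ []
  pg≈0 = monic-*ᴾ-Deg<⇒≈0 m g monic p λ j m≤j → begin
    coeff (p *ᴾ g) j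
      ≡⟨ cong (ℙ._+ coeff (p *ᴾ g) j) (trans (cong (a ℙ.*_) (deg-g (suc j) (s≤s m≤j))) (ℙ.*-zeroʳ a)) ⟨
    (a ℙ.* coeff g (suc j)) ℙ.+ coeff (p *ᴾ g) j
      ≡⟨ coeff-∷-*ᴾ a p g (suc j) ⟨
    coeff ((a ∷ p) *ᴾ g) (suc j)
      ≡⟨ deg (suc j) (≤-trans m≤j (m≤n+m j 1)) ⟩
    0ℙ
      ∎

  tail : ∀ j → coeff (0ℙ ∷ p *ᴾ g) j ≡ 0ℙ
  tail zero    = refl
  tail (suc j) = pg≈0 j

  head-only : ∀ j → coeff ((a ∷ p) *ᴾ g) j ≡ a ℙ.* coeff g j
  head-only j = trans (coeff-∷-*ᴾ a p g j)
    (trans (cong ((a ℙ.* coeff g j) ℙ.+_) (tail j)) (ℙ.+-identityʳ _))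

  a≡0 : a ≡ 0ℙ
  a≡0 = begin
    a                       ≡⟨ ℙ.*-identityʳ a ⟨
    a ℙ.* 1ℙ                ≡⟨ cong (a ℙ.*_) gm≡1 ⟨
    a ℙ.* coeff g m         ≡⟨ head-only m ⟨
    coeff ((a ∷ p) *ᴾ g) m  ≡⟨ deg m ≤-refl ⟩
    0ℙ                      ∎

-- Addition is subtraction here: `R′ + R` equals `(Q′ + Q) g`, a multiple of `g` of degree below
-- `m`, hence zero.
remainder-unique : ∀ m g → MonicOfDegree m g → ∀ P R R′ →
                   IsRemainder m g P R → IsRemainder m g P R′ → R′ ≈ R
remainder-unique m g monic P R R′ (deg-R , Q , P≈) (deg-R′ , Q′ , P≈′) i =
  +≡0⇒≡ (coeff R′ i) (coeff R i) (trans (sym (difference i)) (product≈0 i))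
  where
  difference : ∀ j → coeff ((Q′ +ᴾ Q) *ᴾ g) j ≡ coeff R′ j ℙ.+ coeff R j
  difference j = +≡0⇒≡ _ _ (begin
    coeff ((Q′ +ᴾ Q) *ᴾ g) j ℙ.+ (coeff R′ j ℙ.+ coeff R j)
      ≡⟨ cong (ℙ._+ (coeff R′ j ℙ.+ coeff R j)) (*ᴾ-distribʳ-+ᴾ g Q′ Q j) ⟩
    (coeff (Q′ *ᴾ g) j ℙ.+ coeff (Q *ᴾ g) j) ℙ.+ (coeff R′ j ℙ.+ coeff R j)
      ≡⟨ +-interchange (coeff (Q′ *ᴾ g) j) _ _ _ ⟩
    (coeff (Q′ *ᴾ g) j ℙ.+ coeff R′ j) ℙ.+ (coeff (Q *ᴾ g) j ℙ.+ coeff R j)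
      ≡⟨ cong₂ ℙ._+_ (trans (P≈′ j) (coeff-+ᴾ (Q′ *ᴾ g) R′ j)) (trans (P≈ j) (coeff-+ᴾ (Q *ᴾ g) R j)) ⟨
    coeff P j ℙ.+ coeff P j
      ≡⟨ ℙ.p+p≡0ℙ (coeff P j) ⟩
    0ℙ
      ∎)

  product≈0 : (Q′ +ᴾ Q) *ᴾ g ≈ []
  product≈0 = monic-*ᴾ-Deg<⇒≈0 m g monic (Q′ +ᴾ Q)
    λ j m≤j → trans (difference j) (cong₂ ℙ._+_ (deg-R′ j m≤j) (deg-R j m≤j))

-- Vectors as zero-extended sequences

coeff-⟦⟧ : ∀ {m} (y : Vector 𝔽₂ m) i → coeff ⟦ y ⟧ (toℕ i) ≡ y i
coeff-⟦⟧ y Fin.zero    = refl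
coeff-⟦⟧ y (Fin.suc i) = coeff-⟦⟧ (y ∘ Fin.suc) i

⟦⟧-Deg< : ∀ {m} (y : Vector 𝔽₂ m) → Deg< ⟦ y ⟧ m
⟦⟧-Deg< {zero}  y j       _         = refl
⟦⟧-Deg< {suc m} y (suc j) (s≤s m≤j) = ⟦⟧-Deg< (y ∘ Fin.suc) j m≤j

-- Carries identities from vectors to sequences on all of ℕ, where shifts need no truncation test.
coeff-⟦⟧-unique : ∀ {m} (y : Vector 𝔽₂ m) (s : ℕ → 𝔽₂) → (∀ i → y i ≡ s (toℕ i)) →
                  (∀ j → m ≤ j → s j ≡ 0ℙ) → ∀ j → coeff ⟦ y ⟧ j ≡ s j
coeff-⟦⟧-unique {zero}  y s y≗s s≡0 j       = sym (s≡0 j z≤n)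
coeff-⟦⟧-unique {suc m} y s y≗s s≡0 zero    = y≗s Fin.zero
coeff-⟦⟧-unique {suc m} y s y≗s s≡0 (suc j) =
  coeff-⟦⟧-unique (y ∘ Fin.suc) (s ∘ suc) (y≗s ∘ Fin.suc) (λ k m≤k → s≡0 (suc k) (s≤s m≤k)) j

-- Zero extension absorbs the truncation: reading past the end of `y` gives 0, the value in the
-- failing case.
N^-apply : ∀ {m} d (y : Vector 𝔽₂ m) i → N^ d y i ≡ coeff ⟦ y ⟧ (toℕ i + d)
N^-apply {m} d y i with toℕ i + d <? m
... | yes i+d<m = trans (sym (coeff-⟦⟧ y (fromℕ< i+d<m))) (cong (coeff ⟦ y ⟧) (toℕ-fromℕ< i+d<m))
... | no  i+d≮m = sym (⟦⟧-Deg< y _ (≮⇒≥ i+d≮m))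

-- Powers of the sum of shifts

module _ (ts : List A) (δ : A → ℕ) where

  -- This is U^(2^k), where U is the sum over t ∈ ts of the shifts by δ t, because
  -- of U-square.
  U^2^ : ℕ → (ℕ → 𝔽₂) → ℕ → 𝔽₂
  U^2^ k s j = ∑ ts (λ t → s (j + 2 ^ k * δ t))

  U-cong : ∀ k {s s′} → (∀ j → s j ≡ s′ j) → ∀ j → U^2^ k s j ≡ U^2^ k s′ j
  U-cong k s≗s′ j = ∑-cong ts (λ t → s≗s′ (j + 2 ^ k * δ t))

  U-+ : ∀ k s s′ j → U^2^ k (λ i → s i ℙ.+ s′ i) j ≡ U^2^ k s j ℙ.+ U^2^ k s′ j
  U-+ k s s′ j = ∑-+ ts _ _

  shifts-comm : ∀ (s : ℕ → 𝔽₂) j a b → s ((j + a) + b) ≡ s ((j + b) + a)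
  shifts-comm s j a b =
    cong s (trans (+-assoc j a b) (trans (cong (j +_) (+-comm a b)) (sym (+-assoc j b a))))

  U-comm : ∀ k l s j → U^2^ k (U^2^ l s) j ≡ U^2^ l (U^2^ k s) j
  U-comm k l s j = trans (∑-swap ts ts _)
    (∑-cong ts (λ u → ∑-cong ts (λ t → shifts-comm s j (2 ^ k * δ t) (2 ^ l * δ u))))

  -- The composite is a double sum symmetric in `t` and `u`, so only its diagonal remains, where
  -- each shift is applied twice.
  U-square : ∀ k s j → U^2^ k (U^2^ k s) j ≡ U^2^ (suc k) s j
  U-square k s j = begin
    ∑ ts (λ t → ∑ ts (λ u → s ((j + 2 ^ k * δ t) + 2 ^ k * δ u)))
      ≡⟨ ∑-symmetric ts _ (λ t u → shifts-comm s j (2 ^ k * δ t) (2 ^ k * δ u)) ⟩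
    ∑ ts (λ t → s ((j + 2 ^ k * δ t) + 2 ^ k * δ t))
      ≡⟨ ∑-cong ts (λ t → cong s (trans (+-assoc j _ _) (cong (j +_) (double t)))) ⟩
    ∑ ts (λ t → s (j + 2 ^ suc k * δ t))
      ∎
    where
    double : ∀ t → 2 ^ k * δ t + 2 ^ k * δ t ≡ 2 ^ suc k * δ t
    -- `2 ^ suc k` unfolds to `2 ^ k + (2 ^ k + 0)`, hence the appeal to `+-identityʳ`.
    double t = trans (sym (*-distribʳ-+ (δ t) (2 ^ k) (2 ^ k)))
      (cong (λ n → (2 ^ k + n) * δ t) (sym (+-identityʳ (2 ^ k))))

  -- Write W for `U^2^ k`. The factor I + U commutes past the new factor I + W. The induction
  -- hypothesis turns what it meets into (I + W) applied to `s 0`, and (I + W)(I + W) = I + W²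
  -- because the two middle terms cancel.
  [1+U]-telescope : ∀ (s : ℕ → ℕ → 𝔽₂) → (∀ k j → s (suc k) j ≡ s k j ℙ.+ U^2^ k (s k) j) →
                    ∀ k j → s k j ℙ.+ U^2^ 0 (s k) j ≡ s 0 j ℙ.+ U^2^ k (s 0) j
  [1+U]-telescope s step zero    j = refl
  [1+U]-telescope s step (suc k) j = begin
    s (suc k) j ℙ.+ U^2^ 0 (s (suc k)) j
      ≡⟨ cong₂ ℙ._+_ (step k j) (trans (U-cong 0 (step k) j) (U-+ 0 (s k) (U^2^ k (s k)) j)) ⟩
    (s k j ℙ.+ U^2^ k (s k) j) ℙ.+ (U^2^ 0 (s k) j ℙ.+ U^2^ 0 (U^2^ k (s k)) j)
      ≡⟨ +-interchange (s k j) _ _ _ ⟩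
    (s k j ℙ.+ U^2^ 0 (s k) j) ℙ.+ (U^2^ k (s k) j ℙ.+ U^2^ 0 (U^2^ k (s k)) j)
      ≡⟨ cong (λ z → (s k j ℙ.+ U^2^ 0 (s k) j) ℙ.+ (U^2^ k (s k) j ℙ.+ z)) (U-comm 0 k (s k) j) ⟩
    (s k j ℙ.+ U^2^ 0 (s k) j) ℙ.+ (U^2^ k (s k) j ℙ.+ U^2^ k (U^2^ 0 (s k)) j)
      ≡⟨ cong ((s k j ℙ.+ U^2^ 0 (s k) j) ℙ.+_) (U-+ k (s k) (U^2^ 0 (s k)) j) ⟨
    (s k j ℙ.+ U^2^ 0 (s k) j) ℙ.+ U^2^ k (λ i → s k i ℙ.+ U^2^ 0 (s k) i) j
      ≡⟨ cong₂ ℙ._+_ (IH j) (trans (U-cong k IH j) (U-+ k (s 0) (U^2^ k (s 0)) j)) ⟩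
    (s 0 j ℙ.+ U^2^ k (s 0) j) ℙ.+ (U^2^ k (s 0) j ℙ.+ U^2^ k (U^2^ k (s 0)) j)
      ≡⟨ +-cancel-middle (s 0 j) (U^2^ k (s 0) j) _ ⟩
    s 0 j ℙ.+ U^2^ k (U^2^ k (s 0)) j
      ≡⟨ cong (s 0 j ℙ.+_) (U-square k (s 0) j) ⟩
    s 0 j ℙ.+ U^2^ (suc k) (s 0) j
      ∎
    where
    IH : ∀ j → s k j ℙ.+ U^2^ 0 (s k) j ≡ s 0 j ℙ.+ U^2^ k (s 0) j
    IH = [1+U]-telescope s step k

-- The reduction algorithm

-- On zero-extended sequences a stage is I + U^(2^k) with all of `T`: an exponent outside
-- `active T k` shifts by at least `m` and so contributes zero.
coeff-stage : ∀ {m} (T : List (Fin m)) Y k j →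
              coeff ⟦ stage T Y k ⟧ j ≡ coeff ⟦ Y ⟧ j ℙ.+ U^2^ T Δ k (coeff ⟦ Y ⟧) j
coeff-stage {m} T Y k = coeff-⟦⟧-unique (stage T Y k) _ below above
  where
  below : ∀ i → stage T Y k i ≡ coeff ⟦ Y ⟧ (toℕ i) ℙ.+ U^2^ T Δ k (coeff ⟦ Y ⟧) (toℕ i)
  below i = cong₂ ℙ._+_ (sym (coeff-⟦⟧ Y i))
    (trans (⨁-apply (active T k) (λ t → N^ (2 ^ k * Δ t) Y) i)
      (∑-filter (λ t → 2 ^ k * Δ t <? m) T
        (λ t _ → N^-apply (2 ^ k * Δ t) Y i)
        (λ t inactive → ⟦⟧-Deg< Y _ (≤-trans (≮⇒≥ inactive) (m≤n+m _ (toℕ i))))))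

  above : ∀ j → m ≤ j → coeff ⟦ Y ⟧ j ℙ.+ U^2^ T Δ k (coeff ⟦ Y ⟧) j ≡ 0ℙ
  above j m≤j = cong₂ ℙ._+_ (⟦⟧-Deg< Y j m≤j)
    (∑-zero (All.universal (λ t → ⟦⟧-Deg< Y _ (≤-trans m≤j (m≤m+n j _))) T))

-- Supplies the nonzero divisor for the logarithm bound. For the empty list the minimum is the
-- default `m`, whence `1 ≤ m`.
Δmin-positive : ∀ {m} (T : List (Fin m)) → 1 ≤ m → 1 ≤ Δmin T
Δmin-positive []      1≤m = 1≤m
Δmin-positive (t ∷ T) 1≤m = ⊓-glb (m<n⇒0<n∸m (toℕ<n t)) (Δmin-positive T 1≤m)

Δmin-≤ : ∀ {m} (T : List (Fin m)) → All (λ t → Δmin T ≤ Δ t) T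
Δmin-≤ []      = []
Δmin-≤ (t ∷ T) =
  m⊓n≤m (Δ t) (Δmin T) ∷ All.map (≤-trans (m⊓n≤n (Δ t) (Δmin T))) (Δmin-≤ T)

-- This is the nilpotency bound: every shift in U^(2^r) has length at least `m`, so U^(2^r)
-- annihilates all vectors of length `m`.
m≤2^stageCount*Δ : ∀ {m} (T : List (Fin m)) → 1 ≤ m → All (λ t → m ≤ 2 ^ stageCount T * Δ t) T
m≤2^stageCount*Δ {m} T 1≤m with all? (λ t → toℕ t ≟ 0) T
... | yes t≡0 = All.map (λ {t} t≡0 → ≤-reflexive (sym (trans (*-identityˡ (Δ t)) (cong (m ∸_) t≡0)))) t≡0
... | no  _   = All.map (λ Δmin≤Δ → ≤-trans upper (*-monoʳ-≤ (2 ^ ⌈log₂ m / Δmin T ⌉) Δmin≤Δ)) (Δmin-≤ T)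
  where
  upper : m ≤ 2 ^ ⌈log₂ m / Δmin T ⌉ * Δmin T
  upper = ⌈log₂/⌉-upper m (Δmin T) {{>-nonZero (Δmin-positive T 1≤m)}}

stages : ∀ {m} → List (Fin m) → Vector 𝔽₂ m → ℕ → Vector 𝔽₂ m
stages T H k = foldl (stage T) H (upTo k)

-- Telescoping leaves H + U^(2^r) H, and every shift in the second term reads past the end of `H`.
[1+U]stages≡H : ∀ {m} (T : List (Fin m)) → 1 ≤ m → ∀ H j → let Y = stages T H (stageCount T) in
                coeff ⟦ Y ⟧ j ℙ.+ ∑ T (λ t → coeff ⟦ Y ⟧ (j + Δ t)) ≡ coeff ⟦ H ⟧ j
[1+U]stages≡H T 1≤m H j = begin
  s r j ℙ.+ ∑ T (λ t → s r (j + Δ t))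
    ≡⟨ cong (s r j ℙ.+_) (∑-cong T (λ t → cong (λ d → s r (j + d)) (sym (*-identityˡ (Δ t))))) ⟩
  s r j ℙ.+ U^2^ T Δ 0 (s r) j
    ≡⟨ [1+U]-telescope T Δ s step r j ⟩
  s 0 j ℙ.+ U^2^ T Δ r (s 0) j
    ≡⟨ cong (s 0 j ℙ.+_) (∑-zero (All.map (λ m≤ → ⟦⟧-Deg< H _ (≤-trans m≤ (m≤n+m _ j))) (m≤2^stageCount*Δ T 1≤m))) ⟩
  s 0 j ℙ.+ 0ℙ
    ≡⟨ ℙ.+-identityʳ (s 0 j) ⟩
  s 0 j
    ∎
  where
  r : ℕ
  r = stageCount T

  s : ℕ → ℕ → 𝔽₂
  s k = coeff ⟦ stages T H k ⟧

  step : ∀ k j → s (suc k) j ≡ s k j ℙ.+ U^2^ T Δ k (s k) j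
  -- `upTo (suc k)` is `upTo k` with `k` appended, so stage `k` is the outermost application in the
  -- left fold.
  step k j = trans
    (cong (λ Y → coeff ⟦ Y ⟧ j)
      (trans (cong (foldl (stage T) H) (sym (upTo-∷ʳ k))) (foldl-∷ʳ (stage T) H k (upTo k))))
    (coeff-stage T (stages T H k) k j)

-- Since `m = toℕ t + Δ t`, the part of x^t p from degree `m` upward is `p` shifted by `Δ t`. Thus
-- the high half of Y g becomes Y + U Y.
coeff-X^-*ᴾ-Δ : ∀ {m} (t : Fin m) p i → coeff ((X^ toℕ t) *ᴾ p) (m + i) ≡ coeff p (i + Δ t)
coeff-X^-*ᴾ-Δ {m} t p i =
  trans (cong (coeff ((X^ toℕ t) *ᴾ p)) m+i≡t+[i+Δ]) (coeff-X^-*ᴾ-≥ (toℕ t) p (i + Δ t))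
  where
  m+i≡t+[i+Δ] : m + i ≡ toℕ t + (i + Δ t)
  m+i≡t+[i+Δ] = begin
    m + i                ≡⟨ cong (_+ i) (m+[n∸m]≡n (<⇒≤ (toℕ<n t))) ⟨
    (toℕ t + Δ t) + i    ≡⟨ +-assoc (toℕ t) (Δ t) i ⟩
    toℕ t + (Δ t + i)    ≡⟨ cong (toℕ t +_) (+-comm (Δ t) i) ⟩
    toℕ t + (i + Δ t)    ∎

theorem4p1 : (m : ℕ) → 1 ≤ m → (g A : Poly) → MonicOfDegree m g → Deg< A (2 * m) → IsMod m g A (frobeniusReduce m g A)
theorem4p1 m 1≤m g A monic deg-A = isRemainder , λ R′ → remainder-unique m g monic A ⟦ R ⟧ R′ isRemainder
  where
  T : List (Fin m)
  T = exponents m g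

  Y R : Vector 𝔽₂ m
  Y = stages T (high m A) (stageCount T)
  R = low m A ⊕ V T Y

  below : ∀ i → coeff A (toℕ i) ≡ coeff (⟦ Y ⟧ *ᴾ g +ᴾ ⟦ R ⟧) (toℕ i)
  below i = sym (begin
    coeff (⟦ Y ⟧ *ᴾ g +ᴾ ⟦ R ⟧) (toℕ i)
      ≡⟨ coeff-+ᴾ (⟦ Y ⟧ *ᴾ g) ⟦ R ⟧ (toℕ i) ⟩
    coeff (⟦ Y ⟧ *ᴾ g) (toℕ i) ℙ.+ coeff ⟦ R ⟧ (toℕ i)
      ≡⟨ cong₂ ℙ._+_ (coeff-monic-*ᴾ m g monic ⟦ Y ⟧ (toℕ i)) (coeff-⟦⟧ R i) ⟩
    (coeff ((X^ m) *ᴾ ⟦ Y ⟧) (toℕ i) ℙ.+ v) ℙ.+ (coeff A (toℕ i) ℙ.+ V T Y i)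
      -- Below degree `m` the term x^m Y is absent, and `V T Y` repeats the other terms of Y g; the
      -- two copies of `v` then cancel.
      ≡⟨ cong₂ (λ z w → (z ℙ.+ v) ℙ.+ (coeff A (toℕ i) ℙ.+ w))
           (coeff-X^-*ᴾ-< m ⟦ Y ⟧ (toℕ<n i)) (⨁-apply T (λ t → low m ((X^ toℕ t) *ᴾ ⟦ Y ⟧)) i) ⟩
    v ℙ.+ (coeff A (toℕ i) ℙ.+ v)
      ≡⟨ cong (v ℙ.+_) (ℙ.+-comm (coeff A (toℕ i)) v) ⟩
    v ℙ.+ (v ℙ.+ coeff A (toℕ i))
      ≡⟨ +-cancel-middle 0ℙ v (coeff A (toℕ i)) ⟩
    coeff A (toℕ i)
      ∎)
    where
    v : 𝔽₂
    v = ∑ T (λ t → coeff ((X^ toℕ t) *ᴾ ⟦ Y ⟧) (toℕ i))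

  coeff-high : ∀ i → coeff ⟦ high m A ⟧ i ≡ coeff A (m + i)
  coeff-high = coeff-⟦⟧-unique (high m A) (λ i → coeff A (m + i)) (λ _ → refl)
    -- For `i ≥ m` the index `m + i` is at least `2 * m`, which unfolds to `m + (m + 0)`.
    (λ i m≤i → deg-A (m + i) (+-monoʳ-≤ m (≤-trans (≤-reflexive (+-identityʳ m)) m≤i)))

  above : ∀ i → coeff A (m + i) ≡ coeff (⟦ Y ⟧ *ᴾ g +ᴾ ⟦ R ⟧) (m + i)
  above i = sym (begin
    coeff (⟦ Y ⟧ *ᴾ g +ᴾ ⟦ R ⟧) (m + i)
      ≡⟨ coeff-+ᴾ (⟦ Y ⟧ *ᴾ g) ⟦ R ⟧ (m + i) ⟩
    coeff (⟦ Y ⟧ *ᴾ g) (m + i) ℙ.+ coeff ⟦ R ⟧ (m + i)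
      ≡⟨ cong₂ ℙ._+_ (coeff-monic-*ᴾ m g monic ⟦ Y ⟧ (m + i)) (⟦⟧-Deg< R (m + i) (m≤m+n m i)) ⟩
    (coeff ((X^ m) *ᴾ ⟦ Y ⟧) (m + i) ℙ.+ ∑ T (λ t → coeff ((X^ toℕ t) *ᴾ ⟦ Y ⟧) (m + i))) ℙ.+ 0ℙ
      ≡⟨ ℙ.+-identityʳ _ ⟩
    coeff ((X^ m) *ᴾ ⟦ Y ⟧) (m + i) ℙ.+ ∑ T (λ t → coeff ((X^ toℕ t) *ᴾ ⟦ Y ⟧) (m + i))
      ≡⟨ cong₂ ℙ._+_ (coeff-X^-*ᴾ-≥ m ⟦ Y ⟧ i) (∑-cong T (λ t → coeff-X^-*ᴾ-Δ t ⟦ Y ⟧ i)) ⟩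
    coeff ⟦ Y ⟧ i ℙ.+ ∑ T (λ t → coeff ⟦ Y ⟧ (i + Δ t))
      ≡⟨ [1+U]stages≡H T 1≤m (high m A) i ⟩
    coeff ⟦ high m A ⟧ i
      ≡⟨ coeff-high i ⟩
    coeff A (m + i)
      ∎)

  A≈Yg+R : A ≈ ⟦ Y ⟧ *ᴾ g +ᴾ ⟦ R ⟧
  A≈Yg+R j with j <? m
  ... | yes j<m = subst (λ j → coeff A j ≡ coeff (⟦ Y ⟧ *ᴾ g +ᴾ ⟦ R ⟧) j) (toℕ-fromℕ< j<m) (below (fromℕ< j<m))
  ... | no  j≮m = subst (λ j → coeff A j ≡ coeff (⟦ Y ⟧ *ᴾ g +ᴾ ⟦ R ⟧) j) (m+[n∸m]≡n (≮⇒≥ j≮m)) (above (j ∸ m))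

  isRemainder : IsRemainder m g A ⟦ R ⟧
  isRemainder = ⟦⟧-Deg< R , ⟦ Y ⟧ , A≈Yg+R
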